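{- If a consecution $X\vdash Y$ is valid, i.e. the formula $\Psi(X)\to\Upsilon(Y)$ is CBI-valid, then $X\vdash Y$ is provable in $\mathrm{DL}_{\mathrm{CBI}}$.
   Context: Models: a BBI-model is $\langle R,\circ,e\rangle$ with $e \in R$, $\circ : R\times R\to\mathcal{P}(R)$ commutative and associative (w.r.t. pointwise extension $X\circ Y=\bigcup_{x\in X,y\in Y}x\circ y$), $r\circ e=\{r\}$. A CBI-model is $\langle R,\circ,e,-,\infty\rangle$ with $\langle R,\circ,e\rangle$ a BBI-model, $-:R\to R$, $\infty\in R$, such that for each $x$, $-x$ is the unique element with $\infty\in x\circ(-x)$. CBI-formulas: $F ::= P \mid \top \mid \bot \mid \neg F \mid F\wedge F \mid F \vee F \mid F \to F \mid \top^* \mid \bot^* \mid \mathord{\sim} F \mid F * F \mid F \mathbin{\vee^*} F \mid F \mathrel{ -\!\!*} F$, $P$ ranging over a countably infinite set $\mathcal{V}$. For an environment $\rho:\mathcal{V}\to\mathcal{P}(R)$: $r\models_\rho P$ iff $r\in\rho(P)$; $\top$ always; $\bot$ never; $\neg,\wedge,\vee,\to$ classically pointwise; $r\models_\rho\top^*$ iff $r=e$; $r\models_\rho\bot^*$ iff $r\neq\infty$; $r\models_\rho\mathord{\sim}F$ iff not $-r\models_\rho F$; $r\models_\rho F_1*F_2$ iff $\exists r_1,r_2$ with $r\in r_1\circ r_2$, $r_1\models_\rho F_1$, $r_2\models_\rho F_2$; $r\models_\rho F_1\mathbin{\vee^*}F_2$ iff for all $r_1,r_2$ with $-r\in r_1\circ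 r_2$, $-r_1\models_\rho F_1$ or $-r_2\models_\rho F_2$; $r\models_\rho F_1\mathrel{ -\!\!*}F_2$ iff for all $r',r''$ with $r''\in r\circ r'$ and $r'\models_\rho F_1$, $r''\models_\rho F_2$. CBI-valid: satisfied by every element of every CBI-model under every environment. Structures: $X ::= F \mid \emptyset_a \mid \sharp X \mid X ; X \mid \emptyset_m \mid \flat X \mid X , X$; consecutions $X\vdash Y$. Define $\Psi,\Upsilon$ mutually: $\Psi(F)=\Upsilon(F)=F$; $\Psi(\emptyset_a)=\top$, $\Upsilon(\emptyset_a)=\bot$; $\Psi(\sharp X)=\neg\Upsilon(X)$, $\Upsilon(\sharp X)=\neg\Psi(X)$; $\Psi(X_1;X_2)=\Psi(X_1)\wedge\Psi(X_2)$, $\Upsilon(X_1;X_2)=\Upsilon(X_1)\vee\Upsilon(X_2)$; $\Psi(\emptyset_m)=\top^*$, $\Upsilon(\emptyset_m)=\bot^*$; $\Psi(\flat X)=\mathord{\sim}\Upsilon(X)$, $\Upsilon(\flat X)=\mathord{\sim}\Psi(X)$; $\Psi(X_1,X_2)=\Psi(X_1)*\Psi(X_2)$, $\Upsilon(X_1,X_2)=\Upsilon(X_1)\mathbin{\vee^*}\Upsilon(X_2)$. Display postulates (each line lists consecutions any two of which are interderivable): (1) $X;Y\vdash Z$, $X \vdash \sharp Y ; Z$, $Y;X\vdash Z$; (2) $X\vdash Y;Z$, $X;\sharp Y\vdash Z$, $X\vdash Z;Y$; (3) $X\vdash Y$, $\sharp Y\vdash \sharp X$, $\sharp\sharp X\vdash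 Y$; (4)–(6) the same with $,$ for $;$ and $\flat$ for $\sharp$. Display-equivalence: derivability using only display postulates. Rules of $\mathrm{DL}_{\mathrm{CBI}}$ (premises / conclusion): (Id) $P\vdash P$ for propositional variables $P$; (Cut) $X\vdash F$, $F\vdash Y$ / $X\vdash Y$; ($\equiv_D$) $X'\vdash Y'$ / $X\vdash Y$ when display-equivalent. Logical: $\emptyset_a\vdash X$ / $\top\vdash X$; axiom $\emptyset_a\vdash\top$; $\emptyset_m\vdash X$ / $\top^*\vdash X$; axiom $\emptyset_m\vdash\top^*$; axiom $\bot\vdash\emptyset_a$; $X\vdash\emptyset_a$ / $X\vdash\bot$; axiom $\bot^*\vdash\emptyset_m$; $X\vdash\emptyset_m$ / $X\vdash\bot^*$; $\sharp F\vdash X$ / $\neg F\vdash X$; $X\vdash\sharp F$ / $X\vdash\neg F$; $\flat F\vdash X$ / $\mathord{\sim}F\vdash X$; $X\vdash\flat F$ / $X\vdash\mathord{\sim}F$; $F;G\vdash X$ / $F\wedge G\vdash X$; $X\vdash F$, $Y\vdash G$ / $X;Y\vdash F\wedge G$; $F,G\vdash X$ / $F*G\vdash X$; $X\vdash F$, $Y\vdash G$ / $X,Y\vdash F*G$; $F\vdash X$, $G\vdash Y$ / $F\vee G\vdash X;Y$; $X\vdash F;G$ / $X\vdash F\vee G$; $F\vdash X$, $G\vdash Y$ / $F\mathbin{\vee^*}G\vdash X,Y$; $X\vdash F,G$ / $X\vdash F\mathbin{\vee^*}G$; $X\vdash F$, $G\vdash Y$ / $F\to G\vdash\sharp X;Y$;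 $X;F\vdash G$ / $X\vdash F\to G$; $X\vdash F$, $G\vdash Y$ / $F\mathrel{ -\!\!*}G\vdash\flat X,Y$; $X,F\vdash G$ / $X\vdash F\mathrel{ -\!\!*}G$. Structural (first eight bidirectional): $W;(X;Y)\vdash Z$ ⇔ $(W;X);Y\vdash Z$; $W\vdash(X;Y);Z$ ⇔ $W\vdash X;(Y;Z)$; same two with $,$; $\emptyset_a;X\vdash Y$ ⇔ $X\vdash Y$; $X\vdash Y;\emptyset_a$ ⇔ $X\vdash Y$; $\emptyset_m,X\vdash Y$ ⇔ $X\vdash Y$; $X\vdash Y,\emptyset_m$ ⇔ $X\vdash Y$; $X\vdash Z$ / $X;Y\vdash Z$; $X\vdash Z$ / $X\vdash Y;Z$; $X;X\vdash Z$ / $X\vdash Z$; $X\vdash Z;Z$ / $X\vdash Z$. -}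

module Defs where

open import Data.Nat using (ℕ)
open import Data.Fin using (Fin; zero; suc)
open import Data.Product using (Σ; _×_; _,_)
open import Data.Sum using (_⊎_)
open import Data.Empty using (⊥)
open import Data.Unit using (⊤)
open import Relation.Nullary using (¬_)
open import Relation.Binary.PropositionalEquality using (_≡_)
open import Function.Bundles using (_⇔_)

-- Models
-- A subset of R is a predicate R → Set; r ∘ s is represented by the
-- ternary relation  Comp r s t  meaning  t ∈ r ∘ s.

record BBIModel : Set₁ where
  field
    R    : Set
    Comp : R → R → R → Set          -- Comp x y z  ⇔  z ∈ x ∘ y
    e    : R
    comm  : ∀ x y z → Comp x y z → Comp y x z
    -- (x ∘ y) ∘ z = x ∘ (y ∘ z) w.r.t. the pointwise extension
    assoc : ∀ x y z w →
            (Σ R λ u → Comp x y u × Comp u z w) ⇔ (Σ R λ v → Comp y z v × Comp x v w)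
    unit  : ∀ r s → Comp r e s ⇔ (s ≡ r)

record CBIModel : Set₁ where
  field
    bbi : BBIModel
  open BBIModel bbi public
  field
    minus : R → R
    ∞     : R
    minus-inv    : ∀ x → Comp x (minus x) ∞
    minus-unique : ∀ x y → Comp x y ∞ → y ≡ minus x

Var : Set
Var = ℕ

infixr 30 _∧ᶠ_ _∨ᶠ_ _*ᶠ_ _∨*_
infixr 25 _⇒_ _-*_

data Formula : Set where
  var   : Var → Formula
  ⊤ᶠ ⊥ᶠ : Formula
  ¬ᶠ    : Formula → Formula
  _∧ᶠ_ _∨ᶠ_ _⇒_ : Formula → Formula → Formula
  ⊤* ⊥* : Formula
  ∼ᶠ    : Formula → Formula
  _*ᶠ_ _∨*_ _-*_ : Formula → Formula → Formula

Env : CBIModel → Set₁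
Env M = Var → CBIModel.R M → Set

module _ (M : CBIModel) (ρ : Env M) where
  open CBIModel M

  sat : R → Formula → Set
  sat r (var P)   = ρ P r
  sat r ⊤ᶠ        = ⊤
  sat r ⊥ᶠ        = ⊥
  sat r (¬ᶠ F)    = ¬ sat r F
  sat r (F ∧ᶠ G)  = sat r F × sat r G
  sat r (F ∨ᶠ G)  = sat r F ⊎ sat r G
  sat r (F ⇒ G)   = sat r F → sat r G
  sat r ⊤*        = r ≡ e
  sat r ⊥*        = ¬ (r ≡ ∞)
  sat r (∼ᶠ F)    = ¬ sat (minus r) F
  sat r (F *ᶠ G)  = Σ R λ r₁ → Σ R λ r₂ → Comp r₁ r₂ r × sat r₁ F × sat r₂ G
  sat r (F ∨* G)  = ∀ r₁ r₂ → Comp r₁ r₂ (minus r) → sat (minus r₁) F ⊎ sat (minus r₂) G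
  sat r (F -* G)  = ∀ r′ r″ → Comp r r′ r″ → sat r′ F → sat r″ G

CBIValid : Formula → Set₁
CBIValid F = ∀ (M : CBIModel) (ρ : Env M) (r : CBIModel.R M) → sat M ρ r F

infixr 20 _︔_ _,ˢ_
infix 10 _⊢_

data Structure : Set where
  fm   : Formula → Structure
  ∅a   : Structure
  ♯    : Structure → Structure
  _︔_  : Structure → Structure → Structure
  ∅m   : Structure
  ♭    : Structure → Structure
  _,ˢ_ : Structure → Structure → Structure

data Consecution : Set where
  _⊢_ : Structure → Structure → Consecution

Ψ Υ : Structure → Formula
Ψ (fm F)     = F
Ψ ∅a         = ⊤ᶠ
Ψ (♯ X)      = ¬ᶠ (Υ X)
Ψ (X ︔ Y)    = Ψ X ∧ᶠ Ψ Y
Ψ ∅m         = ⊤*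
Ψ (♭ X)      = ∼ᶠ (Υ X)
Ψ (X ,ˢ Y)   = Ψ X *ᶠ Ψ Y
Υ (fm F)     = F
Υ ∅a         = ⊥ᶠ
Υ (♯ X)      = ¬ᶠ (Ψ X)
Υ (X ︔ Y)    = Υ X ∨ᶠ Υ Y
Υ ∅m         = ⊥*
Υ (♭ X)      = ∼ᶠ (Ψ X)
Υ (X ,ˢ Y)   = Υ X ∨* Υ Y

ValidCons : Consecution → Set₁
ValidCons (X ⊢ Y) = CBIValid (Ψ X ⇒ Υ Y)

-- Display postulates: each line lists three consecutions, any two of
-- which are interderivable.

data DPLine : Set where
  dp1 dp2 dp4 dp5 : Structure → Structure → Structure → DPLine
  dp3 dp6         : Structure → Structure → DPLine

member : DPLine → Fin 3 → Consecution
member (dp1 X Y Z) zero             = X ︔ Y ⊢ Z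
member (dp1 X Y Z) (suc zero)       = X ⊢ ♯ Y ︔ Z
member (dp1 X Y Z) (suc (suc zero)) = Y ︔ X ⊢ Z
member (dp2 X Y Z) zero             = X ⊢ Y ︔ Z
member (dp2 X Y Z) (suc zero)       = X ︔ ♯ Y ⊢ Z
member (dp2 X Y Z) (suc (suc zero)) = X ⊢ Z ︔ Y
member (dp3 X Y) zero               = X ⊢ Y
member (dp3 X Y) (suc zero)         = ♯ Y ⊢ ♯ X
member (dp3 X Y) (suc (suc zero))   = ♯ (♯ X) ⊢ Y
member (dp4 X Y Z) zero             = X ,ˢ Y ⊢ Z
member (dp4 X Y Z) (suc zero)       = X ⊢ ♭ Y ,ˢ Z
member (dp4 X Y Z) (suc (suc zero)) = Y ,ˢ X ⊢ Z
member (dp5 X Y Z) zero             = X ⊢ Y ,ˢ Z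
member (dp5 X Y Z) (suc zero)       = X ,ˢ ♭ Y ⊢ Z
member (dp5 X Y Z) (suc (suc zero)) = X ⊢ Z ,ˢ Y
member (dp6 X Y) zero               = X ⊢ Y
member (dp6 X Y) (suc zero)         = ♭ Y ⊢ ♭ X
member (dp6 X Y) (suc (suc zero))   = ♭ (♭ X) ⊢ Y

data DPStep : Consecution → Consecution → Set where
  step : ∀ (L : DPLine) (i j : Fin 3) → DPStep (member L i) (member L j)

data DispEq : Consecution → Consecution → Set where
  deRefl  : ∀ {C} → DispEq C C
  deStep  : ∀ {C D E} → DPStep C D → DispEq D E → DispEq C E

data Provable : Consecution → Set where
  Id   : ∀ P → Provable (fm (var P) ⊢ fm (var P))
  Cut  : ∀ {X Y F} → Provable (X ⊢ fm F) → Provable (fm F ⊢ Y) → Provable (X ⊢ Y)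
  ≡D   : ∀ {C D} → DispEq C D → Provable C → Provable D
  ⊤L   : ∀ {X} → Provable (∅a ⊢ X) → Provable (fm ⊤ᶠ ⊢ X)
  ⊤R   : Provable (∅a ⊢ fm ⊤ᶠ)
  ⊤*L  : ∀ {X} → Provable (∅m ⊢ X) → Provable (fm ⊤* ⊢ X)
  ⊤*R  : Provable (∅m ⊢ fm ⊤*)
  ⊥L   : Provable (fm ⊥ᶠ ⊢ ∅a)
  ⊥R   : ∀ {X} → Provable (X ⊢ ∅a) → Provable (X ⊢ fm ⊥ᶠ)
  ⊥*L  : Provable (fm ⊥* ⊢ ∅m)
  ⊥*R  : ∀ {X} → Provable (X ⊢ ∅m) → Provable (X ⊢ fm ⊥*)
  ¬L   : ∀ {F X} → Provable (♯ (fm F) ⊢ X) → Provable (fm (¬ᶠ F) ⊢ X)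
  ¬R   : ∀ {F X} → Provable (X ⊢ ♯ (fm F)) → Provable (X ⊢ fm (¬ᶠ F))
  ∼L   : ∀ {F X} → Provable (♭ (fm F) ⊢ X) → Provable (fm (∼ᶠ F) ⊢ X)
  ∼R   : ∀ {F X} → Provable (X ⊢ ♭ (fm F)) → Provable (X ⊢ fm (∼ᶠ F))
  ∧L   : ∀ {F G X} → Provable (fm F ︔ fm G ⊢ X) → Provable (fm (F ∧ᶠ G) ⊢ X)
  ∧R   : ∀ {X Y F G} → Provable (X ⊢ fm F) → Provable (Y ⊢ fm G)
         → Provable (X ︔ Y ⊢ fm (F ∧ᶠ G))
  *L   : ∀ {F G X} → Provable (fm F ,ˢ fm G ⊢ X) → Provable (fm (F *ᶠ G) ⊢ X)
  *R   : ∀ {X Y F G} → Provable (X ⊢ fm F) → Provable (Y ⊢ fm G)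
         → Provable (X ,ˢ Y ⊢ fm (F *ᶠ G))
  ∨L   : ∀ {F G X Y} → Provable (fm F ⊢ X) → Provable (fm G ⊢ Y)
         → Provable (fm (F ∨ᶠ G) ⊢ X ︔ Y)
  ∨R   : ∀ {X F G} → Provable (X ⊢ fm F ︔ fm G) → Provable (X ⊢ fm (F ∨ᶠ G))
  ∨*L  : ∀ {F G X Y} → Provable (fm F ⊢ X) → Provable (fm G ⊢ Y)
         → Provable (fm (F ∨* G) ⊢ X ,ˢ Y)
  ∨*R  : ∀ {X F G} → Provable (X ⊢ fm F ,ˢ fm G) → Provable (X ⊢ fm (F ∨* G))
  ⇒L   : ∀ {X Y F G} → Provable (X ⊢ fm F) → Provable (fm G ⊢ Y)
         → Provable (fm (F ⇒ G) ⊢ ♯ X ︔ Y)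
  ⇒R   : ∀ {X F G} → Provable (X ︔ fm F ⊢ fm G) → Provable (X ⊢ fm (F ⇒ G))
  -*L  : ∀ {X Y F G} → Provable (X ⊢ fm F) → Provable (fm G ⊢ Y)
         → Provable (fm (F -* G) ⊢ ♭ X ,ˢ Y)
  -*R  : ∀ {X F G} → Provable (X ,ˢ fm F ⊢ fm G) → Provable (X ⊢ fm (F -* G))
  AAL₁ : ∀ {W X Y Z} → Provable (W ︔ (X ︔ Y) ⊢ Z) → Provable ((W ︔ X) ︔ Y ⊢ Z)
  AAL₂ : ∀ {W X Y Z} → Provable ((W ︔ X) ︔ Y ⊢ Z) → Provable (W ︔ (X ︔ Y) ⊢ Z)
  AAR₁ : ∀ {W X Y Z} → Provable (W ⊢ (X ︔ Y) ︔ Z) → Provable (W ⊢ X ︔ (Y ︔ Z))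
  AAR₂ : ∀ {W X Y Z} → Provable (W ⊢ X ︔ (Y ︔ Z)) → Provable (W ⊢ (X ︔ Y) ︔ Z)
  MAL₁ : ∀ {W X Y Z} → Provable (W ,ˢ (X ,ˢ Y) ⊢ Z) → Provable ((W ,ˢ X) ,ˢ Y ⊢ Z)
  MAL₂ : ∀ {W X Y Z} → Provable ((W ,ˢ X) ,ˢ Y ⊢ Z) → Provable (W ,ˢ (X ,ˢ Y) ⊢ Z)
  MAR₁ : ∀ {W X Y Z} → Provable (W ⊢ (X ,ˢ Y) ,ˢ Z) → Provable (W ⊢ X ,ˢ (Y ,ˢ Z))
  MAR₂ : ∀ {W X Y Z} → Provable (W ⊢ X ,ˢ (Y ,ˢ Z)) → Provable (W ⊢ (X ,ˢ Y) ,ˢ Z)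
  ∅aL₁ : ∀ {X Y} → Provable (∅a ︔ X ⊢ Y) → Provable (X ⊢ Y)
  ∅aL₂ : ∀ {X Y} → Provable (X ⊢ Y) → Provable (∅a ︔ X ⊢ Y)
  ∅aR₁ : ∀ {X Y} → Provable (X ⊢ Y ︔ ∅a) → Provable (X ⊢ Y)
  ∅aR₂ : ∀ {X Y} → Provable (X ⊢ Y) → Provable (X ⊢ Y ︔ ∅a)
  ∅mL₁ : ∀ {X Y} → Provable (∅m ,ˢ X ⊢ Y) → Provable (X ⊢ Y)
  ∅mL₂ : ∀ {X Y} → Provable (X ⊢ Y) → Provable (∅m ,ˢ X ⊢ Y)
  ∅mR₁ : ∀ {X Y} → Provable (X ⊢ Y ,ˢ ∅m) → Provable (X ⊢ Y)
  ∅mR₂ : ∀ {X Y} → Provable (X ⊢ Y) → Provable (X ⊢ Y ,ˢ ∅m)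
  WkL  : ∀ {X Y Z} → Provable (X ⊢ Z) → Provable (X ︔ Y ⊢ Z)
  WkR  : ∀ {X Y Z} → Provable (X ⊢ Z) → Provable (X ⊢ Y ︔ Z)
  CtrL : ∀ {X Z} → Provable (X ︔ X ⊢ Z) → Provable (X ⊢ Z)
  CtrR : ∀ {X Z} → Provable (X ⊢ Z ︔ Z) → Provable (X ⊢ Z)

{-# OPTIONS --safe #-}

-- A consecution X ⊢ Y is interderivable with Ψ X ⊢ Υ Y, so it suffices to
-- refute unprovable F ⊢ G.  Take maximal consistent sets as worlds, with
-- z ∈ x ∘ y iff F * G ∈ z for all F ∈ x and G ∈ y, and
-- - x = { F ∣ ∼ F ∉ x }.  This frame satisfies the laws of a CBI-model except
-- that every set containing ⊤* is a unit.  However each x has exactly one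
-- unit e with x ∈ x ∘ e, and the worlds sharing a unit are closed under - and
-- under composing and decomposing, so the component of a world refuting
-- F ⊢ G is a CBI-model with infinity - e.
-- The model must have propositional equality, while maximal consistent sets
-- are only extensionally equal.  Therefore a countable Skolem hull of the
-- refuting world is taken, in which every world is represented by its least
-- code.

module Submission where

open import Defs
open import Level using (0ℓ)
open import Axiom.ExcludedMiddle using (ExcludedMiddle)

open import Data.Bool using (Bool; T)
open import Data.Empty using (⊥-elim)
open import Data.Fin using (zero; suc)
open import Data.Nat using (ℕ; zero; suc; _+_; z≤n; s≤s; _≤′_; ≤′-refl; ≤′-step) renaming (_≤_ to _≤ℕ_)
open import Data.Nat.Properties using (+-suc; +-assoc; +-comm; ≤-antisym; ≤-total; ≤⇒≤′; ≡-irrelevant)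
open import Data.Product using (Σ; ∃; _×_; _,_; proj₁; proj₂)
open import Data.Sum using (_⊎_; inj₁; inj₂; [_,_]′; map)
open import Data.Unit using (tt)
open import Function using (_∘_; id)
open import Function.Bundles using (mk⇔)
open import Relation.Binary.PropositionalEquality using (_≡_; refl; sym; trans; cong; cong₂; subst)
open import Relation.Nullary using (¬_; Dec; yes; no)
open import Relation.Nullary.Decidable using (⌊_⌋; toWitness; fromWitness; decidable-stable)

private variable
  A B C D E F G : Formula
  X Y Z : Structure

-- Derived rules of the display calculus

display : ∀ L i j → Provable (member L i) → Provable (member L j)
display L i j = ≡D (deStep (step L i j) deRefl)

pattern 0F = zero
pattern 1F = suc zero
pattern 2F = suc (suc zero)

︔-comm : Provable (X ︔ Y ⊢ Z) → Provable (Y ︔ X ⊢ Z)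
︔-comm = display (dp1 _ _ _) 0F 2F

︔-uncurry : Provable (X ⊢ ♯ Y ︔ Z) → Provable (X ︔ Y ⊢ Z)
︔-uncurry = display (dp1 _ _ _) 1F 0F

︔-commʳ : Provable (X ⊢ Y ︔ Z) → Provable (X ⊢ Z ︔ Y)
︔-commʳ = display (dp2 _ _ _) 0F 2F

♯-anti : Provable (X ⊢ Y) → Provable (♯ Y ⊢ ♯ X)
♯-anti = display (dp3 _ _) 0F 1F

,-comm : Provable (X ,ˢ Y ⊢ Z) → Provable (Y ,ˢ X ⊢ Z)
,-comm = display (dp4 _ _ _) 0F 2F

,-curry : Provable (X ,ˢ Y ⊢ Z) → Provable (X ⊢ ♭ Y ,ˢ Z)
,-curry = display (dp4 _ _ _) 0F 1F

,-uncurry : Provable (X ⊢ ♭ Y ,ˢ Z) → Provable (X ,ˢ Y ⊢ Z)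
,-uncurry = display (dp4 _ _ _) 1F 0F

,-commʳ : Provable (X ⊢ Y ,ˢ Z) → Provable (X ⊢ Z ,ˢ Y)
,-commʳ = display (dp5 _ _ _) 0F 2F

,-moveˡ : Provable (X ⊢ Y ,ˢ Z) → Provable (X ,ˢ ♭ Y ⊢ Z)
,-moveˡ = display (dp5 _ _ _) 0F 1F

,-moveʳ : Provable (X ,ˢ ♭ Y ⊢ Z) → Provable (X ⊢ Y ,ˢ Z)
,-moveʳ = display (dp5 _ _ _) 1F 0F

♭-anti : Provable (X ⊢ Y) → Provable (♭ Y ⊢ ♭ X)
♭-anti = display (dp6 _ _) 0F 1F

♭♭-elimˡ : Provable (♭ (♭ X) ⊢ Y) → Provable (X ⊢ Y)
♭♭-elimˡ = display (dp6 _ _) 2F 0F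

♭-swapʳ : Provable (X ⊢ ♭ Y) → Provable (Y ⊢ ♭ X)
♭-swapʳ = ♭♭-elimˡ ∘ ♭-anti

♭-swapˡ : Provable (♭ X ⊢ Y) → Provable (♭ Y ⊢ X)
♭-swapˡ = display (dp6 _ _) 1F 0F ∘ ♭♭-elimˡ ∘ ♭-anti ∘ ♭-anti

-- Multiplicative contraposition at the level of structures; `*-∼`, `-*-as-∼` and `∨*-as-∼` rest on
-- it.
rotate : Provable (X ,ˢ Y ⊢ Z) → Provable (X ,ˢ ♭ Z ⊢ ♭ Y)
rotate = ,-moveˡ ∘ ,-commʳ ∘ ,-curry

-- Left rules act on a whole antecedent, so the component is displayed first. This moves `Z` to the
-- right, hence the quantification over all `W`.
onLeft : (∀ {W} → Provable (X ⊢ W) → Provable (Y ⊢ W)) → ∀ {W} → Provable (X ,ˢ Z ⊢ W) → Provable (Y ,ˢ Z ⊢ W)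
onLeft f = ,-uncurry ∘ f ∘ ,-curry

onRight : (∀ {W} → Provable (X ⊢ W) → Provable (Y ⊢ W)) → ∀ {W} → Provable (Z ,ˢ X ⊢ W) → Provable (Z ,ˢ Y ⊢ W)
onRight f = ,-comm ∘ onLeft f ∘ ,-comm

identity : ∀ F → Provable (fm F ⊢ fm F)
identity (var P)  = Id P
identity ⊤ᶠ       = ⊤L ⊤R
identity ⊥ᶠ       = ⊥R ⊥L
identity (¬ᶠ F)   = ¬R (¬L (♯-anti (identity F)))
identity (F ∧ᶠ G) = ∧L (∧R (identity F) (identity G))
identity (F ∨ᶠ G) = ∨R (∨L (identity F) (identity G))
identity (F ⇒ G)  = ⇒R (︔-uncurry (⇒L (identity F) (identity G)))
identity ⊤*       = ⊤*L ⊤*R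
identity ⊥*       = ⊥*R ⊥*L
identity (∼ᶠ F)   = ∼R (∼L (♭-anti (identity F)))
identity (F *ᶠ G) = *L (*R (identity F) (identity G))
identity (F ∨* G) = ∨*R (∨*L (identity F) (identity G))
identity (F -* G) = -*R (,-uncurry (-*L (identity F) (identity G)))

mutual
  -- Both directions go by one induction because `♯` and `♭` exchange the two sides.
  ⊢Ψ : ∀ X → Provable (X ⊢ fm (Ψ X))
  ⊢Ψ (fm F)   = identity F
  ⊢Ψ ∅a       = ⊤R
  ⊢Ψ (♯ X)    = ¬R (♯-anti (Υ⊢ X))
  ⊢Ψ (X ︔ Y)  = ∧R (⊢Ψ X) (⊢Ψ Y)
  ⊢Ψ ∅m       = ⊤*R
  ⊢Ψ (♭ X)    = ∼R (♭-anti (Υ⊢ X))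
  ⊢Ψ (X ,ˢ Y) = *R (⊢Ψ X) (⊢Ψ Y)

  Υ⊢ : ∀ X → Provable (fm (Υ X) ⊢ X)
  Υ⊢ (fm F)   = identity F
  Υ⊢ ∅a       = ⊥L
  Υ⊢ (♯ X)    = ¬L (♯-anti (⊢Ψ X))
  Υ⊢ (X ︔ Y)  = ∨L (Υ⊢ X) (Υ⊢ Y)
  Υ⊢ ∅m       = ⊥*L
  Υ⊢ (♭ X)    = ∼L (♭-anti (⊢Ψ X))
  Υ⊢ (X ,ˢ Y) = ∨*L (Υ⊢ X) (Υ⊢ Y)

-- The Lindenbaum algebra

infix 4 _≤_

_≤_ : Formula → Formula → Set
A ≤ B = Provable (fm A ⊢ fm B)

≤-refl : A ≤ A
≤-refl = identity _

≤-trans : A ≤ B → B ≤ C → A ≤ C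
≤-trans = Cut

∧-lower₁ : A ∧ᶠ B ≤ A
∧-lower₁ = ∧L (WkL ≤-refl)

∧-lower₂ : A ∧ᶠ B ≤ B
∧-lower₂ = ∧L (︔-comm (WkL ≤-refl))

∧-greatest : C ≤ A → C ≤ B → C ≤ A ∧ᶠ B
∧-greatest p q = CtrL (∧R p q)

∧-mono : A ≤ B → C ≤ D → A ∧ᶠ C ≤ B ∧ᶠ D
∧-mono p q = ∧L (∧R p q)

∨-upper₁ : A ≤ A ∨ᶠ B
∨-upper₁ = ∨R (︔-commʳ (WkR ≤-refl))

∨-upper₂ : B ≤ A ∨ᶠ B
∨-upper₂ = ∨R (WkR ≤-refl)

∨-least : A ≤ C → B ≤ C → A ∨ᶠ B ≤ C
∨-least p q = CtrR (∨L p q)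

≤-⊤ : A ≤ ⊤ᶠ
≤-⊤ = ∅aL₁ (WkL ⊤R)

⊥⊢ : Provable (fm ⊥ᶠ ⊢ X)
⊥⊢ = ∅aR₁ (WkR ⊥L)

⇒-intro : A ∧ᶠ B ≤ C → A ≤ B ⇒ C
⇒-intro p = ⇒R (Cut (∧R ≤-refl ≤-refl) p)

⇒-elim : A ≤ B ⇒ C → A ∧ᶠ B ≤ C
⇒-elim p = ∧L (︔-uncurry (Cut p (⇒L ≤-refl ≤-refl)))

contradictory : A ∧ᶠ ¬ᶠ A ≤ ⊥ᶠ
contradictory = ∧L (︔-comm (︔-uncurry (︔-commʳ (WkR (¬L (♯-anti ≤-refl))))))

exhaustive : B ≤ A ∨ᶠ ¬ᶠ A
exhaustive = ∨R (display (dp2 _ _ _) 1F 0F (¬R (︔-comm (WkL (♯-anti ≤-refl)))))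

∧-swap : A ∧ᶠ B ≤ B ∧ᶠ A
∧-swap = ∧-greatest ∧-lower₂ ∧-lower₁

∧-assoc : (A ∧ᶠ B) ∧ᶠ C ≤ A ∧ᶠ (B ∧ᶠ C)
∧-assoc = ∧-greatest (≤-trans ∧-lower₁ ∧-lower₁) (∧-mono ∧-lower₂ ≤-refl)

-- Distributivity of `∧ᶠ` over `∨ᶠ` comes from residuation with `⇒`.
by-cases : ∀ A → D ∧ᶠ A ≤ E → D ∧ᶠ ¬ᶠ A ≤ E → D ≤ E
by-cases A p q = ≤-trans (∧-greatest (exhaustive {A = A}) ≤-refl)
  (⇒-elim (∨-least (⇒-intro (≤-trans ∧-swap p)) (⇒-intro (≤-trans ∧-swap q))))

∼-anti : A ≤ B → ∼ᶠ B ≤ ∼ᶠ A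
∼-anti p = ∼R (∼L (♭-anti p))

∼∼-elim : ∼ᶠ (∼ᶠ A) ≤ A
∼∼-elim = ∼L (♭-swapˡ (∼R (♭-anti ≤-refl)))

∼∼-intro : A ≤ ∼ᶠ (∼ᶠ A)
∼∼-intro = ∼R (♭-swapʳ (∼L (♭-anti ≤-refl)))

∼-swap : ∼ᶠ A ≤ B → ∼ᶠ B ≤ A
∼-swap p = ≤-trans (∼-anti p) ∼∼-elim

-- De Morgan's laws hold because `∼ᶠ` is an order-reversing involution. They make `opposite` closed
-- under meets and total.
∼-∧ : ∼ᶠ (A ∧ᶠ B) ≤ ∼ᶠ A ∨ᶠ ∼ᶠ B
∼-∧ = ∼-swap (∧-greatest (∼-swap ∨-upper₁) (∼-swap ∨-upper₂))

∼-∨ : ∼ᶠ A ∧ᶠ ∼ᶠ B ≤ ∼ᶠ (A ∨ᶠ B)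
∼-∨ = ≤-trans ∼∼-intro (∼-anti (∨-least (≤-trans ∼∼-intro (∼-anti ∧-lower₁)) (≤-trans ∼∼-intro (∼-anti ∧-lower₂))))

∼-⊥ : A ≤ ∼ᶠ ⊥ᶠ
∼-⊥ = ≤-trans ∼∼-intro (∼-anti ⊥⊢)

*-mono : A ≤ B → C ≤ D → A *ᶠ C ≤ B *ᶠ D
*-mono p q = *L (*R p q)

*-comm : A *ᶠ B ≤ B *ᶠ A
*-comm = *L (,-comm (*R ≤-refl ≤-refl))

*-assoc : (A *ᶠ B) *ᶠ C ≤ A *ᶠ (B *ᶠ C)
*-assoc = *L (onLeft *L (MAL₁ (*R ≤-refl (*R ≤-refl ≤-refl))))

*-unit : A *ᶠ ⊤* ≤ A
*-unit = *L (onRight ⊤*L (,-comm (∅mL₂ ≤-refl)))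

*-unit⁻¹ : A ≤ A *ᶠ ⊤*
*-unit⁻¹ = ∅mL₁ (,-comm (*R ≤-refl ⊤*R))

-- Multiplication is residuated: once the join is displayed, both branches have the same succedent
-- and contraction merges the copies.
*-∨ : A *ᶠ B ≤ D → A *ᶠ C ≤ D → A *ᶠ (B ∨ᶠ C) ≤ D
*-∨ p q = *L (,-comm (,-uncurry (CtrR (∨L (,-curry (,-comm (Cut (*R ≤-refl ≤-refl) p)))
                                          (,-curry (,-comm (Cut (*R ≤-refl ≤-refl) q)))))))

*-⊥ : A *ᶠ ⊥ᶠ ≤ ⊥ᶠ
*-⊥ = *L (,-comm (,-uncurry ⊥⊢))

*-∼ : F *ᶠ ∼ᶠ (F *ᶠ G) ≤ ∼ᶠ G
*-∼ = *L (∼R (onRight ∼L (rotate (*R ≤-refl ≤-refl))))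

-- This and the next five entailments reduce `-*`, `∨*` and `⊥*` to `*ᶠ`, `∼ᶠ` and `⊤*`, so that the
-- truth lemma can argue through composition and opposites of worlds.
-*-as-∼ : F -* G ≤ ∼ᶠ (F *ᶠ ∼ᶠ G)
-*-as-∼ = ∼R (♭-swapʳ (*L (onRight ∼L (rotate (,-comm (,-uncurry (-*L ≤-refl ≤-refl)))))))

-*-from-∼ : ∼ᶠ (F *ᶠ ∼ᶠ G) ≤ F -* G
-*-from-∼ = -*R (onLeft ∼L (,-comm (,-moveˡ (,-commʳ (,-moveʳ (*R ≤-refl (∼R (♭-anti ≤-refl))))))))

∨*-as-∼ : F ∨* G ≤ ∼ᶠ (∼ᶠ F *ᶠ ∼ᶠ G)
∨*-as-∼ = ∼R (♭-swapʳ (*L (onLeft ∼L (onRight ∼L (rotate (,-comm (,-moveˡ (∨*L ≤-refl ≤-refl))))))))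

∨*-from-∼ : ∼ᶠ (∼ᶠ F *ᶠ ∼ᶠ G) ≤ F ∨* G
∨*-from-∼ = ∨*R (∼L (,-moveʳ (,-comm (,-moveˡ (,-commʳ (,-moveʳ
  (*R (∼R (♭-anti ≤-refl)) (∼R (♭-anti ≤-refl)))))))))

⊥*-as-∼ : ⊥* ≤ ∼ᶠ ⊤*
⊥*-as-∼ = ∼R (♭-swapʳ (⊤*L (∅mR₁ (,-curry (∅mL₂ ⊥*L)))))

⊥*-from-∼ : ∼ᶠ ⊤* ≤ ⊥*
⊥*-from-∼ = ⊥*R (∼L (∅mL₁ (,-moveˡ (∅mR₂ ⊤*R))))

-- Enumerations

-- Cantor's enumeration: one step along an antidiagonal, or from its end to the start of the next.
step-pair : ℕ × ℕ → ℕ × ℕ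
step-pair (zero , b)  = suc b , zero
step-pair (suc a , b) = a , suc b

unpair : ℕ → ℕ × ℕ
unpair zero    = zero , zero
unpair (suc n) = step-pair (unpair n)

unpair-surjective : ∀ a b → ∃ λ n → unpair n ≡ (a , b)
unpair-surjective a b = along a b (start (b + a))
  where
  next : ∀ {p} → (∃ λ n → unpair n ≡ p) → ∃ λ n → unpair n ≡ step-pair p
  next (n , eq) = suc n , cong step-pair eq

  along : ∀ a b → (∃ λ n → unpair n ≡ (b + a , 0)) → ∃ λ n → unpair n ≡ (a , b)
  along a zero    p = p
  along a (suc b) p = next (along (suc a) b (subst (λ s → ∃ λ n → unpair n ≡ (s , 0)) (sym (+-suc b a)) p))

  start : ∀ s → ∃ λ n → unpair n ≡ (s , 0)
  start zero    = 0 , refl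
  start (suc s) = next (along 0 s (subst (λ s → ∃ λ n → unpair n ≡ (s , 0)) (sym (+-comm s 0)) (start s)))

-- One coding serves twice: trees are read as formulas by `formula` and as Skolem terms by `hull`.
data Tree : Set where
  leaf : ℕ → Tree
  node : ℕ → Tree → Tree → Tree

-- The first argument bounds the depth of the result.
mutual
  decode : ℕ → ℕ → Tree
  decode zero    c = leaf zero
  decode (suc k) c = decode-pair k (unpair c)

  decode-pair : ℕ → ℕ × ℕ → Tree
  decode-pair k (zero , n)  = leaf n
  decode-pair k (suc t , c) = node t (decode k (proj₁ (unpair c))) (decode k (proj₂ (unpair c)))

-- The slack `k` lets two subtrees with different bounds be decoded under the sum of the bounds.
decode-surjective : ∀ t → ∃ λ k₀ → ∃ λ c → ∀ k → decode (k₀ + k) c ≡ t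
decode-surjective (leaf n) with unpair-surjective 0 n
... | c , eq = 1 , c , λ k → cong (decode-pair k) eq
decode-surjective (node n t u)
  with decode-surjective t | decode-surjective u
... | k₁ , a , p | k₂ , b , q with unpair-surjective a b
... | d , eq with unpair-surjective (suc n) d
... | c , eq′ = suc (k₁ + k₂) , c , λ k → trans (cong (decode-pair (k₁ + k₂ + k)) eq′)
  (cong₂ (node n)
    (trans (cong₂ decode (+-assoc k₁ k₂ k) (cong proj₁ eq)) (p (k₂ + k)))
    (trans (cong₂ decode (trans (cong (_+ k) (+-comm k₁ k₂)) (+-assoc k₂ k₁ k)) (cong proj₂ eq)) (q (k₁ + k))))

tree : ℕ → Tree
tree n = decode (proj₁ (unpair n)) (proj₂ (unpair n))

-- Abstract because unfolding the search for a code makes conversion checking explode.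
abstract
  tree-surjective : ∀ t → ∃ λ n → tree n ≡ t
  tree-surjective t with decode-surjective t
  ... | k , c , p with unpair-surjective (k + 0) c
  ... | n , eq = n , trans (cong₂ decode (cong proj₁ eq) (cong proj₂ eq)) (p 0)

formula : Tree → Formula
formula (leaf n)      = var n
formula (node 0 _ _)  = ⊤ᶠ
formula (node 1 _ _)  = ⊥ᶠ
formula (node 2 t _)  = ¬ᶠ (formula t)
formula (node 3 t u)  = formula t ∧ᶠ formula u
formula (node 4 t u)  = formula t ∨ᶠ formula u
formula (node 5 t u)  = formula t ⇒ formula u
formula (node 6 _ _)  = ⊤*
formula (node 7 _ _)  = ⊥*
formula (node 8 t _)  = ∼ᶠ (formula t)
formula (node 9 t u)  = formula t *ᶠ formula u
formula (node 10 t u) = formula t ∨* formula u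
-- All labels from 11 on give `-*`, which makes the function total; `formula⁻¹` uses 11.
formula (node _ t u)  = formula t -* formula u

formula⁻¹ : Formula → Tree
formula⁻¹ (var n)  = leaf n
formula⁻¹ ⊤ᶠ       = node 0 (leaf 0) (leaf 0)
formula⁻¹ ⊥ᶠ       = node 1 (leaf 0) (leaf 0)
formula⁻¹ (¬ᶠ F)   = node 2 (formula⁻¹ F) (leaf 0)
formula⁻¹ (F ∧ᶠ G) = node 3 (formula⁻¹ F) (formula⁻¹ G)
formula⁻¹ (F ∨ᶠ G) = node 4 (formula⁻¹ F) (formula⁻¹ G)
formula⁻¹ (F ⇒ G)  = node 5 (formula⁻¹ F) (formula⁻¹ G)
formula⁻¹ ⊤*       = node 6 (leaf 0) (leaf 0)
formula⁻¹ ⊥*       = node 7 (leaf 0) (leaf 0)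
formula⁻¹ (∼ᶠ F)   = node 8 (formula⁻¹ F) (leaf 0)
formula⁻¹ (F *ᶠ G) = node 9 (formula⁻¹ F) (formula⁻¹ G)
formula⁻¹ (F ∨* G) = node 10 (formula⁻¹ F) (formula⁻¹ G)
formula⁻¹ (F -* G) = node 11 (formula⁻¹ F) (formula⁻¹ G)

formula-formula⁻¹ : ∀ F → formula (formula⁻¹ F) ≡ F
formula-formula⁻¹ (var n)  = refl
formula-formula⁻¹ ⊤ᶠ       = refl
formula-formula⁻¹ ⊥ᶠ       = refl
formula-formula⁻¹ (¬ᶠ F)   = cong ¬ᶠ (formula-formula⁻¹ F)
formula-formula⁻¹ (F ∧ᶠ G) = cong₂ _∧ᶠ_ (formula-formula⁻¹ F) (formula-formula⁻¹ G)
formula-formula⁻¹ (F ∨ᶠ G) = cong₂ _∨ᶠ_ (formula-formula⁻¹ F) (formula-formula⁻¹ G)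
formula-formula⁻¹ (F ⇒ G)  = cong₂ _⇒_ (formula-formula⁻¹ F) (formula-formula⁻¹ G)
formula-formula⁻¹ ⊤*       = refl
formula-formula⁻¹ ⊥*       = refl
formula-formula⁻¹ (∼ᶠ F)   = cong ∼ᶠ (formula-formula⁻¹ F)
formula-formula⁻¹ (F *ᶠ G) = cong₂ _*ᶠ_ (formula-formula⁻¹ F) (formula-formula⁻¹ G)
formula-formula⁻¹ (F ∨* G) = cong₂ _∨*_ (formula-formula⁻¹ F) (formula-formula⁻¹ G)
formula-formula⁻¹ (F -* G) = cong₂ _-*_ (formula-formula⁻¹ F) (formula-formula⁻¹ G)

formula-surjective : ∀ F → ∃ λ n → formula (tree n) ≡ F
formula-surjective F with tree-surjective (formula⁻¹ F)
... | n , eq = n , trans (cong formula eq) (formula-formula⁻¹ F)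

-- Maximal consistent sets

-- The characteristic function is Bool-valued so that MCS lives in Set, where
-- excluded middle acts as a choice principle.
record MCS : Set where
  field
    char   : Formula → Bool
    upward : A ≤ B → T (char A) → T (char B)
    meet   : T (char A) → T (char B) → T (char (A ∧ᶠ B))
    proper : ¬ T (char ⊥ᶠ)
    total  : ∀ A → T (char A) ⊎ T (char (¬ᶠ A))

infix 4 _∈_ _∉_ _⊆_

record _∈_ (F : Formula) (x : MCS) : Set where
  constructor mem
  field holds : T (MCS.char x F)

_∉_ : Formula → MCS → Set
F ∉ x = ¬ (F ∈ x)

_⊆_ : MCS → MCS → Set
x ⊆ y = ∀ F → F ∈ x → F ∈ y

private variable
  w x x′ y y′ z z′ u e : MCS

∈-upward : A ≤ B → A ∈ x → B ∈ x
∈-upward {x = x} p (mem a) = mem (MCS.upward x p a)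

∈-meet : A ∈ x → B ∈ x → A ∧ᶠ B ∈ x
∈-meet {x = x} (mem a) (mem b) = mem (MCS.meet x a b)

∈-proper : ⊥ᶠ ∉ x
∈-proper {x = x} (mem a) = MCS.proper x a

∈-total : ∀ A → A ∈ x ⊎ ¬ᶠ A ∈ x
∈-total {x = x} A = map mem mem (MCS.total x A)

∈-top : ⊤ᶠ ∈ x
∈-top = [ ∈-upward ≤-⊤ , ∈-upward ≤-⊤ ]′ (∈-total ⊤ᶠ)

∈-consistent : A ∈ x → ¬ᶠ A ∉ x
∈-consistent a b = ∈-proper (∈-upward contradictory (∈-meet a b))

∉⇒¬∈ : A ∉ x → ¬ᶠ A ∈ x
∉⇒¬∈ {A = A} a = [ ⊥-elim ∘ a , id ]′ (∈-total A)

∈-stable : ¬ (A ∉ x) → A ∈ x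
∈-stable {A = A} a = [ id , (λ b → ⊥-elim (a λ c → ∈-consistent c b)) ]′ (∈-total A)

∈-prime : A ∨ᶠ B ∈ x → A ∈ x ⊎ B ∈ x
∈-prime {A = A} {B = B} a with ∈-total A
... | inj₁ p = inj₁ p
... | inj₂ p = inj₂ (∈-upward (⇒-elim (∨-least
        (⇒-intro (≤-trans contradictory ⊥⊢)) (⇒-intro ∧-lower₁))) (∈-meet a p))

∈-⇒ : (A ∈ x → B ∈ x) → A ⇒ B ∈ x
∈-⇒ {A = A} f with ∈-total A
... | inj₁ a = ∈-upward (⇒-intro ∧-lower₁) (f a)
... | inj₂ a = ∈-upward (⇒-intro (≤-trans ∧-swap (≤-trans contradictory ⊥⊢))) a

-- By maximality, inclusion already is extensional equality; it is used as such from here on.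
⊆-sym : x ⊆ y → y ⊆ x
⊆-sym p F a = ∈-stable λ b → ∈-consistent a (p _ (∉⇒¬∈ b))

⊆-trans : x ⊆ y → y ⊆ z → x ⊆ z
⊆-trans p q F a = q F (p F a)

-- Composition of maximal consistent sets

record Composes (x y z : MCS) : Set where
  constructor composes
  field compose : F ∈ x → G ∈ y → F *ᶠ G ∈ z
open Composes

Composes-comm : Composes x y z → Composes y x z
Composes-comm c = composes λ f g → ∈-upward *-comm (compose c g f)

Composes-resp : x ⊆ x′ → y ⊆ y′ → z ⊆ z′ → Composes x y z → Composes x′ y′ z′
Composes-resp p q r c = composes λ f g → r _ (compose c (⊆-sym p _ f) (⊆-sym q _ g))

unit-unique : ⊤* ∈ e → Composes x e y → x ⊆ y
unit-unique i c F f = ∈-upward *-unit (compose c f i)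

-- Filter bases, the partial worlds that `factor` extends to maximal consistent sets.
record MeetClosed : Set₁ where
  field
    Member : Formula → Set
    top    : Member ⊤ᶠ
    meet   : Member A → Member B → Member (A ∧ᶠ B)
open MeetClosed

above : Formula → MeetClosed
above F = record { Member = F ≤_ ; top = ≤-⊤ ; meet = ∧-greatest }

elements : MCS → MeetClosed
elements x = record { Member = _∈ x ; top = ∈-top ; meet = ∈-meet }

products : MCS → MCS → MeetClosed
products y z = record
  { Member = λ A → ∃ λ G → ∃ λ H → G ∈ y × H ∈ z × G *ᶠ H ≤ A
  ; top    = _ , _ , ∈-top , ∈-top , ≤-⊤ {A = ⊤ᶠ *ᶠ ⊤ᶠ}
  ; meet   = λ (_ , _ , g , h , p) (_ , _ , g′ , h′ , p′) → _ , _ , ∈-meet g g′ , ∈-meet h h′ ,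
      ∧-greatest (≤-trans (*-mono ∧-lower₁ ∧-lower₁) p) (≤-trans (*-mono ∧-lower₂ ∧-lower₂) p′) }

-- Existence of maximal consistent sets

module Classical (em : ExcludedMiddle 0ℓ) where

  by-contradiction : {P : Set} → ¬ ¬ P → P
  by-contradiction = decidable-stable em

  -- Consistency is replaced by an arbitrary upward closed predicate that splits; `separate` and
  -- `factor` each supply their own.
  module Lindenbaum
    (Good : Formula → Set)
    (good-upward : ∀ {A B} → A ≤ B → Good A → Good B)
    (good-⊤ : Good ⊤ᶠ)
    (good-⊥ : ¬ Good ⊥ᶠ)
    (good-split : ∀ {C} A → Good C → Good (C ∧ᶠ A) ⊎ Good (C ∧ᶠ ¬ᶠ A))
    where

    refine : ∀ A → Σ Formula Good → Σ Formula Good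
    refine A (C , g) = [ (C ∧ᶠ A ,_) , (C ∧ᶠ ¬ᶠ A ,_) ]′ (good-split A g)

    refine-≤ : ∀ A c → proj₁ (refine A c) ≤ proj₁ c
    refine-≤ A (C , g) with good-split A g
    ... | inj₁ _ = ∧-lower₁
    ... | inj₂ _ = ∧-lower₁

    refine-decides : ∀ A c → proj₁ (refine A c) ≤ A ⊎ proj₁ (refine A c) ≤ ¬ᶠ A
    refine-decides A (C , g) with good-split A g
    ... | inj₁ _ = inj₁ ∧-lower₂
    ... | inj₂ _ = inj₂ ∧-lower₂

    chain : ℕ → Σ Formula Good
    chain zero    = ⊤ᶠ , good-⊤
    chain (suc n) = refine (formula (tree n)) (chain n)

    chain-descends : ∀ {m n} → m ≤′ n → proj₁ (chain n) ≤ proj₁ (chain m)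
    chain-descends ≤′-refl     = ≤-refl
    chain-descends (≤′-step {n = n} p) = ≤-trans (refine-≤ (formula (tree n)) (chain n)) (chain-descends p)

    Limit : Formula → Set
    Limit A = ∃ λ n → proj₁ (chain n) ≤ A

    limit-good : ∀ {A} → Limit A → Good A
    limit-good (n , p) = good-upward p (proj₂ (chain n))

    limit-meet : ∀ {A B} → Limit A → Limit B → Limit (A ∧ᶠ B)
    limit-meet (m , p) (n , q) with ≤-total m n
    ... | inj₁ m≤n = n , ∧-greatest (≤-trans (chain-descends (≤⇒≤′ m≤n)) p) q
    ... | inj₂ n≤m = m , ∧-greatest p (≤-trans (chain-descends (≤⇒≤′ n≤m)) q)

    limit-total : ∀ A → Limit A ⊎ Limit (¬ᶠ A)
    limit-total A with formula-surjective A
    ... | n , refl = map (suc n ,_) (suc n ,_) (refine-decides (formula (tree n)) (chain n))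

    extension : MCS
    extension = record
      { char   = λ A → ⌊ em {Limit A} ⌋
      ; upward = λ p a → let n , q = toWitness a in fromWitness (n , ≤-trans q p)
      ; meet   = λ a b → fromWitness (limit-meet (toWitness a) (toWitness b))
      ; proper = λ a → good-⊥ (limit-good (toWitness a))
      ; total  = λ A → map fromWitness fromWitness (limit-total A) }

    extension-good : ∀ {A} → A ∈ extension → Good A
    extension-good (mem a) = limit-good (toWitness a)

  abstract
    -- A formula is good if adding it to `F` does not entail `G`; then neither `¬ᶠ F` nor `G` is
    -- good.
    separate : ¬ (F ≤ G) → ∃ λ x → F ∈ x × G ∉ x
    separate {F} {G} F≰G = extension , ∈-stable (λ f → extension-good (∉⇒¬∈ f) (≤-trans contradictory ⊥⊢)) ,
                       λ g → extension-good g ∧-lower₂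
      where
      open Lindenbaum (λ C → ¬ (F ∧ᶠ C ≤ G))
        (λ p g q → g (≤-trans (∧-mono ≤-refl p) q))
        (λ p → F≰G (≤-trans (∧-greatest ≤-refl ≤-⊤) p))
        (λ g → g (≤-trans ∧-lower₂ ⊥⊢))
        (λ {C} A g → by-contradiction λ h → h (inj₁ λ p → h (inj₂ λ q → g
          (by-cases A (≤-trans ∧-assoc p) (≤-trans ∧-assoc q)))))

    -- In the split, the two failing instances are merged by taking meets.
    factor : (Φ Θ : MeetClosed) (w : MCS) → (∀ {A B} → Member Φ A → Member Θ B → A *ᶠ B ∈ w) →
             ∃ λ v → (∀ {B} → Member Θ B → B ∈ v) × (∀ {A B} → Member Φ A → B ∈ v → A *ᶠ B ∈ w)
    factor Φ Θ w prod = extension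
        , (λ b → ∈-stable λ b∉ → ∈-proper (∈-upward (≤-trans (*-mono ≤-refl contradictory) *-⊥)
                                   (extension-good (∉⇒¬∈ b∉) (top Φ) b)))
        , (λ a b → ∈-upward (*-mono ≤-refl ∧-lower₂) (extension-good b a (top Θ)))
      where
      Good : Formula → Set
      -- `C` can be added to `Θ` with all products with `Φ` still in `w`.
      Good C = ∀ {A B} → Member Φ A → Member Θ B → A *ᶠ (B ∧ᶠ C) ∈ w

      split : ∀ {C} A → Good C → Good (C ∧ᶠ A) ⊎ Good (C ∧ᶠ ¬ᶠ A)
      split {C} A g = by-contradiction λ h →
        h (inj₁ λ {F} {B} f b → ∈-stable λ out → h (inj₂ λ {F′} {B′} f′ b′ →
          [ ⊥-elim ∘ out , id ]′ (∈-prime (∈-upward (merge F F′ B B′) (g (meet Φ f f′) (meet Θ b b′))))))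
        where
        merge : ∀ F F′ B B′ → (F ∧ᶠ F′) *ᶠ ((B ∧ᶠ B′) ∧ᶠ C) ≤ (F *ᶠ (B ∧ᶠ (C ∧ᶠ A))) ∨ᶠ (F′ *ᶠ (B′ ∧ᶠ (C ∧ᶠ ¬ᶠ A)))
        merge F F′ B B′ = ≤-trans
          (*-mono ≤-refl (by-cases A
            (≤-trans (∧-greatest (≤-trans ∧-lower₁ (≤-trans ∧-lower₁ ∧-lower₁)) (∧-mono ∧-lower₂ ≤-refl)) ∨-upper₁)
            (≤-trans (∧-greatest (≤-trans ∧-lower₁ (≤-trans ∧-lower₁ ∧-lower₂)) (∧-mono ∧-lower₂ ≤-refl)) ∨-upper₂)))
          (*-∨ (≤-trans (*-mono ∧-lower₁ ≤-refl) ∨-upper₁) (≤-trans (*-mono ∧-lower₂ ≤-refl) ∨-upper₂))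

      open Lindenbaum Good
        (λ p g a b → ∈-upward (*-mono ≤-refl (∧-mono ≤-refl p)) (g a b))
        (λ a b → ∈-upward (*-mono ≤-refl (∧-greatest ≤-refl ≤-⊤)) (prod a b))
        (λ g → ∈-proper (∈-upward (≤-trans (*-mono ≤-refl ∧-lower₂) *-⊥) (g (top Φ) (top Θ))))
        split

  -- One side is extended at a time: `F` to `x` against the principal filter of `G`, then `G` to `y`
  -- against all of `x`.
  decompose : F *ᶠ G ∈ w → ∃ λ x → ∃ λ y → F ∈ x × G ∈ y × Composes x y w
  decompose {F} {G} {w} h
    with factor (above G) (above F) w (λ p q → ∈-upward (≤-trans *-comm (*-mono p q)) h)
  ... | x , F∈x , G*x with factor (elements x) (above G) w (λ a q → ∈-upward *-comm (G*x q a))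
  ... | y , G∈y , c = x , y , F∈x ≤-refl , G∈y ≤-refl , composes c

  -- The products of `y` and `z` generate a filter that already composes with `x` into `w`; `factor`
  -- extends it to `v`.
  reassociate : Composes x y u → Composes u z w → ∃ λ v → Composes y z v × Composes x v w
  reassociate {x} {y} {u} {z} {w} c d
    with factor (elements x) (products y z) w
           (λ f (_ , _ , g , h , p) → ∈-upward (≤-trans *-assoc (*-mono ≤-refl p)) (compose d (compose c f g) h))
  ... | v , in-v , k = v , composes (λ g h → in-v (_ , _ , g , h , ≤-refl)) , composes k

  unit-exists : ∀ x → ∃ λ e → ⊤* ∈ e × Composes x e x
  unit-exists x with factor (elements x) (above ⊤*) x
                       (λ f p → ∈-upward (≤-trans *-unit⁻¹ (*-mono ≤-refl p)) f)
  ... | e , in-e , c = e , in-e ≤-refl , composes c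

  -- Multiplicative negation on maximal consistent sets

  opposite : MCS → MCS
  opposite x = record
    { char   = λ F → ⌊ em {∼ᶠ F ∉ x} ⌋
    ; upward = λ p a → fromWitness λ b → toWitness a (∈-upward (∼-anti p) b)
    ; meet   = λ a b → fromWitness λ c → [ toWitness a , toWitness b ]′ (∈-prime (∈-upward ∼-∧ c))
    ; proper = λ a → toWitness a (∈-upward ∼-⊥ ∈-top)
    -- If `x` contained both `∼ᶠ A` and `∼ᶠ (¬ᶠ A)`, it would contain `∼ᶠ (A ∨ᶠ ¬ᶠ A)`, which
    -- entails `⊥ᶠ`.
    ; total  = λ A → by-contradiction λ h → h (inj₁ (fromWitness λ a → h (inj₂ (fromWitness λ b →
        ∈-proper (∈-upward (≤-trans ∼-∨ (∼-swap (≤-trans ≤-⊤ exhaustive))) (∈-meet a b)))))) }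

  ∈-opposite : ∼ᶠ F ∉ x → F ∈ opposite x
  ∈-opposite h = mem (fromWitness h)

  ∈-opposite⁻¹ : F ∈ opposite x → ∼ᶠ F ∉ x
  ∈-opposite⁻¹ (mem h) = toWitness h

  opposite-mono : x ⊆ y → opposite x ⊆ opposite y
  opposite-mono p F a = ∈-opposite λ b → ∈-opposite⁻¹ a (⊆-sym p _ b)

  opposite-involutive : opposite (opposite x) ⊆ x
  opposite-involutive F a = ∈-stable λ b → ∈-opposite⁻¹ a (∈-opposite λ c → b (∈-upward ∼∼-elim c))

  opposite-swap : opposite x ⊆ y → opposite y ⊆ x
  opposite-swap p = ⊆-trans (opposite-mono (⊆-sym p)) opposite-involutive

  -- If `∼ᶠ (F *ᶠ G)` were in `y`, composing with `F` would put `∼ᶠ G` into `z`, against `G` being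
  -- in the opposite of `z`.
  Composes-rotate : Composes x y z → Composes x (opposite z) (opposite y)
  Composes-rotate c = composes λ f g → ∈-opposite λ h → ∈-opposite⁻¹ g (∈-upward *-∼ (compose c f h))

  Composes-unrotate : Composes x (opposite z) (opposite y) → Composes x y z
  Composes-unrotate c = Composes-resp (λ _ → id) opposite-involutive opposite-involutive (Composes-rotate c)

  least : (P : ℕ → Set) → ∀ n → P n → ∃ λ m → P m × (∀ k → P k → m ≤ℕ k)
  least P zero    p = zero , p , λ _ _ → z≤n
  least P (suc n) p with em {P zero}
  ... | yes p₀ = zero , p₀ , λ _ _ → z≤n
  ... | no ¬p₀ with least (P ∘ suc) n p
  ... | m , q , minimal = suc m , q , λ { zero p₀ → ⊥-elim (¬p₀ p₀) ; (suc k) p′ → s≤s (minimal k p′) }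

  -- The component of a world and its unit

  module Component (root e : MCS) (⊤*∈e : ⊤* ∈ e) (root-e : Composes root e root) where

    record World : Set where
      constructor world
      field
        theory : MCS
        local  : Composes theory e theory
    open World

    -- Since z ∈ (e ∘ y) ∘ y′, some v has z ∈ e ∘ v, and v equals z because e is a unit.
    local-composite : Composes y y′ z → Composes y e y → Composes z e z
    local-composite c l with reassociate (Composes-comm l) c
    ... | v , _ , d = Composes-comm (Composes-resp (λ _ → id) (unit-unique ⊤*∈e (Composes-comm d)) (λ _ → id) d)

    -- Since w ∈ (x ∘ y) ∘ e, the set y ∘ e has an element, which can only be y.
    local-factor : Composes x y w → Composes w e w → Composes y e y
    local-factor c l with reassociate c l
    ... | v , d , _ = Composes-resp (λ _ → id) (λ _ → id) (⊆-sym (unit-unique ⊤*∈e d)) d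

    unitᵂ : World
    unitᵂ = world e (local-factor root-e root-e)

    oppositeᵂ : World → World
    oppositeᵂ (world x l) = world (opposite x) (Composes-comm (Composes-rotate (Composes-comm l)))

    Decomposition : World → Formula → Formula → Set
    Decomposition w F G = Σ (World × World) λ (x , y) → F ∈ theory x × G ∈ theory y × Composes (theory x) (theory y) (theory w)

    -- The Skolem functions must be total to be applied in terms; `w , w` is an arbitrary value
    -- where no decomposition exists, like `x` in `middle`.
    factors : ∀ w F G → Dec (Decomposition w F G) → World × World
    factors w F G (yes (p , _)) = p
    factors w F G (no _)        = w , w

    factorsᵂ : World → Formula → Formula → World × World
    factorsᵂ w F G = factors w F G em

    factorsᵂ-correct : ∀ w → F *ᶠ G ∈ theory w → let x , y = factorsᵂ w F G in
                       F ∈ theory x × G ∈ theory y × Composes (theory x) (theory y) (theory w)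
    factorsᵂ-correct {F} {G} w h with em {Decomposition w F G}
    ... | yes (_ , c) = c
    ... | no ¬d with decompose h
    ... | x , y , f , g , c = ⊥-elim (¬d ((world x (local-factor (Composes-comm c) (local w)) , world y (local-factor c (local w))) , f , g , c))

    Reassociation : (x y z w : World) → Set
    Reassociation x y z w = Σ World λ v → Composes (theory y) (theory z) (theory v) × Composes (theory x) (theory v) (theory w)

    middle : ∀ x y z w → Dec (Reassociation x y z w) → World
    middle x y z w (yes (v , _)) = v
    middle x y z w (no _)        = x

    middleᵂ : (x y z w : World) → World
    middleᵂ x y z w = middle x y z w em

    middleᵂ-correct : ∀ x y z w → Composes (theory x) (theory y) u → Composes u (theory z) (theory w) →
      let v = middleᵂ x y z w in Composes (theory y) (theory z) (theory v) × Composes (theory x) (theory v) (theory w)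
    middleᵂ-correct x y z w c d with em {Reassociation x y z w}
    ... | yes (_ , p) = p
    ... | no ¬r with reassociate c d
    ... | v , p , q = ⊥-elim (¬r (world v (local-composite p (local y)) , p , q))

    -- The Skolem hull: trees serve as terms over the Skolem functions above.
    hull : Tree → World
    hull (leaf zero)                          = world root root-e
    hull (leaf (suc _))                       = unitᵂ
    hull (node 0 t _)                         = oppositeᵂ (hull t)
    hull (node 1 t (node _ f g))              = proj₁ (factorsᵂ (hull t) (formula f) (formula g))
    hull (node 2 t (node _ f g))              = proj₂ (factorsᵂ (hull t) (formula f) (formula g))
    hull (node 3 (node _ x y) (node _ z w))   = middleᵂ (hull x) (hull y) (hull z) (hull w)
    hull _                                    = unitᵂ

    -- Representatives modulo extensional equality

    th : ℕ → MCS
    th n = theory (hull (tree n))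

    least-code : ∀ n → ∃ λ m → th m ⊆ th n × (∀ k → th k ⊆ th n → m ≤ℕ k)
    least-code n = least (λ m → th m ⊆ th n) n (λ _ → id)

    rep : ℕ → ℕ
    rep n = proj₁ (least-code n)

    rep-⊆ : ∀ n → th (rep n) ⊆ th n
    rep-⊆ n = proj₁ (proj₂ (least-code n))

    rep-cong : ∀ m n → th m ⊆ th n → rep m ≡ rep n
    rep-cong m n p = ≤-antisym
      (proj₂ (proj₂ (least-code m)) _ (⊆-trans (rep-⊆ n) (⊆-sym p)))
      (proj₂ (proj₂ (least-code n)) _ (⊆-trans (rep-⊆ m) p))

    -- The quotient by extensional equality, realised as the fixed points of `rep`.
    Point : Set
    Point = Σ ℕ λ n → rep n ≡ n

    termOf : Point → Tree
    termOf (n , _) = tree n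

    ⟦_⟧ : Point → MCS
    ⟦ n , _ ⟧ = th n

    Point-≡ : ∀ r s → ⟦ r ⟧ ⊆ ⟦ s ⟧ → r ≡ s
    Point-≡ (m , p) (n , q) h with trans (sym p) (trans (rep-cong m n h) q)
    ... | refl = cong (m ,_) (≡-irrelevant p q)

    -- The chosen code may denote another term with the same theory, so facts are transferred along
    -- `point-⊆`.
    point : Tree → Point
    point t = let n = proj₁ (tree-surjective t) in rep n , rep-cong (rep n) n (rep-⊆ n)

    point-⊆ : ∀ t → ⟦ point t ⟧ ⊆ theory (hull t)
    point-⊆ t = subst (λ t′ → ⟦ point t ⟧ ⊆ theory (hull t′)) (proj₂ (tree-surjective t))
                  (rep-⊆ (proj₁ (tree-surjective t)))

    -- The CBI-model on the hull

    Compᴾ : Point → Point → Point → Set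
    Compᴾ r s t = Composes ⟦ r ⟧ ⟦ s ⟧ ⟦ t ⟧

    eᴾ : Point
    eᴾ = point (leaf 1)

    ⊤*∈eᴾ : ⊤* ∈ ⟦ eᴾ ⟧
    ⊤*∈eᴾ = ⊆-sym (point-⊆ (leaf 1)) _ ⊤*∈e

    Compᴾ-unit : ∀ r → Compᴾ r eᴾ r
    Compᴾ-unit r = Composes-resp (λ _ → id) (⊆-sym (point-⊆ (leaf 1))) (λ _ → id) (local (hull (termOf r)))

    minusᴾ : Point → Point
    minusᴾ r = point (node 0 (termOf r) (leaf 0))

    minusᴾ-⊆ : ∀ r → ⟦ minusᴾ r ⟧ ⊆ opposite ⟦ r ⟧
    minusᴾ-⊆ r = point-⊆ (node 0 (termOf r) (leaf 0))

    Compᴾ-assoc : ∀ x y z w → (Σ Point λ u → Compᴾ x y u × Compᴾ u z w) → Σ Point λ v → Compᴾ y z v × Compᴾ x v w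
    Compᴾ-assoc x y z w (u , c , d)
      with middleᵂ-correct (hull (termOf x)) (hull (termOf y)) (hull (termOf z)) (hull (termOf w)) c d
    ... | p , q = point v , Composes-resp (λ _ → id) (λ _ → id) (⊆-sym (point-⊆ v)) p
                          , Composes-resp (λ _ → id) (⊆-sym (point-⊆ v)) (λ _ → id) q
      where v = node 3 (node 0 (termOf x) (termOf y)) (node 0 (termOf z) (termOf w))

    Compᴾ-assoc⁻¹ : ∀ x y z w → (Σ Point λ v → Compᴾ y z v × Compᴾ x v w) → Σ Point λ u → Compᴾ x y u × Compᴾ u z w
    Compᴾ-assoc⁻¹ x y z w (v , c , d) with Compᴾ-assoc z y x w (v , Composes-comm c , Composes-comm d)
    ... | u , p , q = u , Composes-comm p , Composes-comm q

    model : CBIModel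
    model = record
      { bbi = record
        { R     = Point
        ; Comp  = Compᴾ
        ; e     = eᴾ
        ; comm  = λ _ _ _ → Composes-comm
        ; assoc = λ x y z w → mk⇔ (Compᴾ-assoc x y z w) (Compᴾ-assoc⁻¹ x y z w)
        ; unit  = λ r s → mk⇔ (λ c → sym (Point-≡ r s (unit-unique ⊤*∈eᴾ c))) (λ { refl → Compᴾ-unit r }) }
      ; minus = minusᴾ
      ; ∞     = minusᴾ eᴾ
      -- Rotating x ∈ x ∘ e gives -e ∈ x ∘ -x. Conversely, -e ∈ x ∘ y rotates back to -y ∈ x ∘ e, so
      -- x = -y and y = -x.
      ; minus-inv = λ x → Composes-resp (λ _ → id) (⊆-sym (minusᴾ-⊆ x)) (⊆-sym (minusᴾ-⊆ eᴾ))
                            (Composes-rotate (Compᴾ-unit x))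
      ; minus-unique = λ x y c → Point-≡ y (minusᴾ x) (⊆-trans
          (⊆-sym (opposite-swap (⊆-sym (unit-unique ⊤*∈eᴾ (Composes-unrotate
            (Composes-resp (λ _ → id) (⊆-sym opposite-involutive) (minusᴾ-⊆ eᴾ) c))))))
          (⊆-sym (minusᴾ-⊆ x))) }

    -- The truth lemma

    valuation : Env model
    valuation P r = var P ∈ ⟦ r ⟧

    ∼∈⇒∉minus : ∀ r → ∼ᶠ F ∈ ⟦ r ⟧ → F ∉ ⟦ minusᴾ r ⟧
    ∼∈⇒∉minus r a b = ∈-opposite⁻¹ (minusᴾ-⊆ r _ b) a

    ∉minus⇒∼∈ : ∀ r → F ∉ ⟦ minusᴾ r ⟧ → ∼ᶠ F ∈ ⟦ r ⟧
    ∉minus⇒∼∈ r a = ∈-stable λ b → a (⊆-sym (minusᴾ-⊆ r) _ (∈-opposite b))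

    -- The hull is closed under decomposition: its terms labelled 1 and 2 supply the factors.
    decomposeᴾ : ∀ r → F *ᶠ G ∈ ⟦ r ⟧ → Σ Point λ s → Σ Point λ t → Compᴾ s t r × F ∈ ⟦ s ⟧ × G ∈ ⟦ t ⟧
    decomposeᴾ {F} {G} r h = point (term 1) , point (term 2) ,
        Composes-resp (⊆-sym in₁) (⊆-sym in₂) (λ _ → id) (proj₂ (proj₂ ok)) ,
        ⊆-sym in₁ _ (proj₁ ok) , ⊆-sym in₂ _ (proj₁ (proj₂ ok))
      where
      term : ℕ → Tree
      -- The inner label 0 is arbitrary; `hull` reads only the two formula codes under it.
      term i = node i (termOf r) (node 0 (formula⁻¹ F) (formula⁻¹ G))
      ok = factorsᵂ-correct (hull (termOf r)) h
      fs = factorsᵂ (hull (termOf r))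
      in₁ : ⟦ point (term 1) ⟧ ⊆ theory (proj₁ (fs F G))
      in₁ = subst (⟦ point (term 1) ⟧ ⊆_)
              (cong₂ (λ F G → theory (proj₁ (fs F G))) (formula-formula⁻¹ F) (formula-formula⁻¹ G)) (point-⊆ (term 1))
      in₂ : ⟦ point (term 2) ⟧ ⊆ theory (proj₂ (fs F G))
      in₂ = subst (⟦ point (term 2) ⟧ ⊆_)
              (cong₂ (λ F G → theory (proj₂ (fs F G))) (formula-formula⁻¹ F) (formula-formula⁻¹ G)) (point-⊆ (term 2))

    -- Here r ∈ e ∘ r; if r is a unit as well, this forces e = r.
    unit-only : ∀ r → ⊤* ∈ ⟦ r ⟧ → r ≡ eᴾ
    unit-only r i = sym (Point-≡ eᴾ r (unit-unique i (Composes-comm (Compᴾ-unit r))))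

    minusᴾ-involutive : ∀ r → minusᴾ (minusᴾ r) ≡ r
    minusᴾ-involutive r = Point-≡ _ r (⊆-trans (minusᴾ-⊆ (minusᴾ r)) (opposite-swap (⊆-sym (minusᴾ-⊆ r))))

    Compᴾ-rotate : ∀ r s t → Compᴾ r s t → Compᴾ r (minusᴾ t) (minusᴾ s)
    Compᴾ-rotate r s t c = Composes-resp (λ _ → id) (⊆-sym (minusᴾ-⊆ t)) (⊆-sym (minusᴾ-⊆ s)) (Composes-rotate c)

    mutual
      -- The two directions depend on each other through the contravariant arguments of `¬ᶠ`, `⇒`,
      -- `∼ᶠ` and `-*`.
      truth : ∀ F r → F ∈ ⟦ r ⟧ → sat model valuation r F
      truth (var P)  r h = h
      truth ⊤ᶠ       r h = tt
      truth ⊥ᶠ       r h = ∈-proper h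
      truth (¬ᶠ F)   r h = λ f → ∈-consistent (truth⁻¹ F r f) h
      truth (F ∧ᶠ G) r h = truth F r (∈-upward ∧-lower₁ h) , truth G r (∈-upward ∧-lower₂ h)
      truth (F ∨ᶠ G) r h = map (truth F r) (truth G r) (∈-prime h)
      truth (F ⇒ G)  r h = λ f → truth G r (∈-upward (⇒-elim ≤-refl) (∈-meet h (truth⁻¹ F r f)))
      truth ⊤*       r h = unit-only r h
      truth ⊥*       r h = λ { refl → ∼∈⇒∉minus r (∈-upward ⊥*-as-∼ h)
                                 (subst (λ s → ⊤* ∈ ⟦ s ⟧) (sym (minusᴾ-involutive eᴾ)) ⊤*∈eᴾ) }
      truth (∼ᶠ F)   r h = λ f → ∼∈⇒∉minus r h (truth⁻¹ F (minusᴾ r) f)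
      truth (F *ᶠ G) r h with decomposeᴾ r h
      ... | s , t , c , f , g = s , t , c , truth F s f , truth G t g
      truth (F ∨* G) r h s t c with em {F ∈ ⟦ minusᴾ s ⟧}
      ... | yes f = inj₁ (truth F (minusᴾ s) f)
      ... | no ¬f = inj₂ (truth G (minusᴾ t) (∈-stable λ ¬g → ∼∈⇒∉minus r (∈-upward ∨*-as-∼ h)
                      (compose c (∉minus⇒∼∈ s ¬f) (∉minus⇒∼∈ t ¬g))))
      -- Rotating t ∈ r ∘ s gives -r ∈ s ∘ -t, so if `G` failed at t, `F *ᶠ ∼ᶠ G` would hold at -r.
      truth (F -* G) r h s t c f = truth G t (∈-stable λ ¬g → ∼∈⇒∉minus r (∈-upward -*-as-∼ h)
        (compose (Compᴾ-rotate s r t (Composes-comm c)) (truth⁻¹ F s f)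
          (∉minus⇒∼∈ (minusᴾ t) λ g → ¬g (subst (λ q → G ∈ ⟦ q ⟧) (minusᴾ-involutive t) g))))

      truth⁻¹ : ∀ F r → sat model valuation r F → F ∈ ⟦ r ⟧
      truth⁻¹ (var P)  r h = h
      truth⁻¹ ⊤ᶠ       r h = ∈-top
      truth⁻¹ ⊥ᶠ       r ()
      truth⁻¹ (¬ᶠ F)   r h = ∉⇒¬∈ λ f → h (truth F r f)
      truth⁻¹ (F ∧ᶠ G) r (f , g) = ∈-meet (truth⁻¹ F r f) (truth⁻¹ G r g)
      truth⁻¹ (F ∨ᶠ G) r = [ ∈-upward ∨-upper₁ ∘ truth⁻¹ F r , ∈-upward ∨-upper₂ ∘ truth⁻¹ G r ]′
      truth⁻¹ (F ⇒ G)  r h = ∈-⇒ λ f → truth⁻¹ G r (h (truth F r f))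
      truth⁻¹ ⊤*       r refl = ⊤*∈eᴾ
      truth⁻¹ ⊥*       r h = ∈-upward ⊥*-from-∼ (∉minus⇒∼∈ r λ i →
        h (trans (sym (minusᴾ-involutive r)) (cong minusᴾ (unit-only (minusᴾ r) i))))
      truth⁻¹ (∼ᶠ F)   r h = ∉minus⇒∼∈ r λ f → h (truth F (minusᴾ r) f)
      truth⁻¹ (F *ᶠ G) r (s , t , c , f , g) = compose c (truth⁻¹ F s f) (truth⁻¹ G t g)
      truth⁻¹ (F ∨* G) r h = ∈-upward ∨*-from-∼ (∉minus⇒∼∈ r λ k →
        let s , t , c , f , g = decomposeᴾ (minusᴾ r) k in
        [ ∼∈⇒∉minus s f ∘ truth⁻¹ F (minusᴾ s) , ∼∈⇒∉minus t g ∘ truth⁻¹ G (minusᴾ t) ]′ (h s t c))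
      -- Rotating -r ∈ s ∘ t gives -t ∈ r ∘ s, so the hypothesis yields `G` at -t, against `∼ᶠ G` at
      -- t.
      truth⁻¹ (F -* G) r h = ∈-upward -*-from-∼ (∉minus⇒∼∈ r λ k →
        let s , t , c , f , g = decomposeᴾ (minusᴾ r) k in
        ∼∈⇒∉minus t g (truth⁻¹ G (minusᴾ t) (h s (minusᴾ t)
          (Composes-comm (subst (λ q → Compᴾ s q (minusᴾ t)) (minusᴾ-involutive r) (Compᴾ-rotate s t (minusᴾ r) c)))
          (truth F s f))))

  -- Completeness

  complete : CBIValid (F ⇒ G) → F ≤ G
  complete {F} {G} valid = by-contradiction λ F≰G →
    let x , f , ¬g = separate F≰G
        e , i , c  = unit-exists x
        open Component x e i c
        -- `leaf 0` is the term for the root, here the world `x` that contains `F` but not `G`.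
        r = point (leaf 0)
    in ¬g (point-⊆ (leaf 0) _ (truth⁻¹ G r (valid model valuation r (truth F r (⊆-sym (point-⊆ (leaf 0)) _ f)))))

theorem3p12 : ExcludedMiddle 0ℓ →
    ∀ (X Y : Structure) → CBIValid (Ψ X ⇒ Υ Y) → Provable (X ⊢ Y)
theorem3p12 em X Y valid = Cut (⊢Ψ X) (Cut (Classical.complete em valid) (Υ⊢ Y))
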